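{- $S_d(5,1)\ge 2d$; that is, for every $d>0$, every search algorithm for $5$ robots, at most $1$ of which is byzantine faulty, has (worst-case) search time at least $2d$ for a target at distance $d$ from the origin.
   Context: Model. $n$ robots with distinct identities start at time $0$ at the origin of the real line and move along the line with speed at most $1$, changing direction or speed at no cost. A target lies at an unknown point at distance $d>0$ from the origin, i.e. at $d$ or $-d$, with $d$ unknown to the robots. At most $f$ robots are faulty; the bound $f$ is known, but not which robots are faulty. A search algorithm assigns each robot a trajectory, known to all robots; a robot's further motion may depend on the messages broadcast so far (computation and communication take no time). A robot detects whether the target is at a point only by being there. The only messages are announcements "the target is here", heard instantly by all robots at any distance; each message automatically carries the true identity and true current location of its sender. A robot visiting a point silently is taken to claim that the target is not there. Reliable (non-faulty) robots follow the algorithm and report truthfully. Faulty robots are controlled by an adversary: they may stay silent at the target or announce the target where it is not; a faulty robot that broadcasts while off its assigned trajectory is thereby detected as faulty. The search is completed at the first time when some reliable robot has visited the target and announced it and all reliable robots can be certain of its location (every scenario with at most $f$ faulty robots consistent with the messages so far has the target at that location). For an algorithm, the search time $S_d(n,f)$ is the worst-case completion time over both positions $\pm d$ of the target, all choices of at most $f$ faulty robots, and all behaviours of the faulty robots. -}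

module Defs where

open import Level using (0ℓ; suc)
open import Algebra.Bundles using (CommutativeRing)
open import Data.Fin.Base using (Fin)
open import Data.Fin.Subset using (Subset; ∣_∣; _∉_)
open import Data.List.Base using (List)
import Data.List.Membership.Setoid as Membership
import Data.Nat.Base as ℕ
open import Data.Nat.Base using (ℕ)
open import Data.Product.Base using (_×_; _,_; ∃; ∃-syntax)
open import Data.Product.Relation.Binary.Pointwise.NonDependent using (×-setoid)
open import Data.Sum.Base using (_⊎_)
open import Function.Bundles using (_⇔_)
open import Relation.Binary.Bundles using (Setoid)
open import Relation.Binary.Core using (Rel)
open import Relation.Binary.Structures using (IsStrictTotalOrder)
import Relation.Binary.Construct.StrictToNonStrict as StrictToNonStrict
import Relation.Binary.PropositionalEquality.Properties as ≡
open import Relation.Nullary.Negation.Core using (¬_)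

-- The real numbers in their classical axiomatic description, which fixes them
-- up to isomorphism: a totally ordered field in which every inhabited
-- predicate that is bounded above has a least upper bound.
record RealNumbers : Set (suc 0ℓ) where
  infix 4 _<_
  field
    commutativeRing : CommutativeRing 0ℓ 0ℓ
  open CommutativeRing commutativeRing public renaming (Carrier to ℝ)
  field
    _<_                : Rel ℝ 0ℓ
    isStrictTotalOrder : IsStrictTotalOrder _≈_ _<_
    0<1                : 0# < 1#
    +-monoˡ-<          : ∀ z {x y} → x < y → x + z < y + z
    *-pos              : ∀ {x y} → 0# < x → 0# < y → 0# < x * y
    invertible         : ∀ {x} → x ≉ 0# → ∃[ y ] x * y ≈ 1#

  open StrictToNonStrict _≈_ _<_ public using (_≤_)

  IsUpperBound : (ℝ → Set) → ℝ → Set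
  IsUpperBound P u = ∀ x → P x → x ≤ u

  field
    complete : (P : ℝ → Set) → ∃ P → ∃ (IsUpperBound P) →
               ∃[ s ] IsUpperBound P s × (∀ u → IsUpperBound P u → s ≤ u)

  2# : ℝ
  2# = 1# + 1#

-- Search on the line by n robots, at most f of them faulty.
module Search (R : RealNumbers) (n f : ℕ) where
  open RealNumbers R

  -- Position as a function of time t ≥ 0.
  record IsTrajectory (p : ℝ → ℝ) : Set where
    field
      start : p 0# ≈ 0#
      speed : ∀ {s t} → 0# ≤ s → s ≤ t →
              p t - p s ≤ t - s × p s - p t ≤ t - s

  -- (i , t , y): at time t robot i, being at y, announces "the target is here".
  messageSetoid : Setoid 0ℓ 0ℓ
  messageSetoid = ×-setoid (≡.setoid (Fin n)) (×-setoid setoid setoid)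

  Message : Set
  Message = Setoid.Carrier messageSetoid

  open Membership messageSetoid public using (_∈_)

  -- The announcements made in the course of a search.  Only membership is
  -- ever used, so neither order nor multiplicity carries information.
  Log : Set
  Log = List Message

  AgreeUpTo : ℝ → Log → Log → Set
  AgreeUpTo t L L′ =
    ∀ i s y → s ≤ t → (i , s , y) ∈ L ⇔ (i , s , y) ∈ L′

  -- plan i L t is the position assigned to robot i at time t when the
  -- announcements are those in L; causality says that those made after t
  -- are irrelevant.
  record Algorithm : Set where
    field
      plan       : Fin n → Log → ℝ → ℝ
      trajectory : ∀ i L → IsTrajectory (plan i L)
      causal     : ∀ i {L L′ t} → 0# ≤ t → AgreeUpTo t L L′ →
                   plan i L t ≈ plan i L′ t

  FirstVisit : (ℝ → ℝ) → ℝ → ℝ → Set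
  FirstVisit p x t = p t ≈ x × (∀ s → 0# ≤ s → s < t → p s ≉ x)

  -- A possible scenario during the time interval [0, T].  Faulty robots are
  -- constrained only by the speed bound and by the authenticity of the
  -- sender and location of every message (`located`).
  record Run (A : Algorithm) (T : ℝ) : Set where
    open Algorithm A using (plan)
    field
      target     : ℝ
      target≉0   : target ≉ 0#
      faulty     : Subset n
      few        : ∣ faulty ∣ ℕ.≤ f
      position   : Fin n → ℝ → ℝ
      trajectory : ∀ i → IsTrajectory (position i)
      log        : Log
      located    : ∀ {i t y} → (i , t , y) ∈ log →
                   0# ≤ t × t ≤ T × position i t ≈ y
      follows    : ∀ {i} → i ∉ faulty → ∀ {t} → 0# ≤ t → t ≤ T →
                   position i t ≈ plan i log t
      -- By `located`, the place y announced here is the target.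
      reports    : ∀ {i} → i ∉ faulty → ∀ {t} → 0# ≤ t → t ≤ T →
                   (∃[ y ] (i , t , y) ∈ log) ⇔ FirstVisit (position i) target t

  module _ {A : Algorithm} {T : ℝ} (ρ : Run A T) where
    open Run ρ

    Announced : ℝ → Set
    Announced t = ∃[ i ] i ∉ faulty × (∃[ s ] s ≤ t × (i , s , target) ∈ log)

    -- Every scenario consistent with the messages up to time t has the same
    -- target.
    Certain : ℝ → Set
    Certain t = (ρ′ : Run A t) → AgreeUpTo t log (Run.log ρ′) →
                Run.target ρ′ ≈ target

    CompletedBy : ℝ → Set
    CompletedBy t = Announced t × Certain t

  AtDistance : ℝ → ℝ → Set
  AtDistance d x = x ≈ d ⊎ x ≈ - d

  -- The worst-case completion time for targets at distance d is at most T.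
  SearchTime≤ : Algorithm → ℝ → ℝ → Set
  SearchTime≤ A d T = (ρ : Run A T) → AtDistance d (Run.target ρ) →
                      ∃[ t ] t ≤ T × CompletedBy ρ t

  -- The search time is the supremum of the completion times, so it is at
  -- least b exactly when each of its upper bounds is.  It is infinite, hence
  -- at least every b, when there is no upper bound.
  SearchTime≥ : Algorithm → ℝ → ℝ → Set
  SearchTime≥ A d b = ∀ T → SearchTime≤ A d T → b ≤ T

module Submission where

-- Suppose some T < 2d bounds the search time, and let t₀ < d satisfy
-- T < t₀ + d; nothing can be announced at ±d by time t₀.  A robot that is on
-- the wrong side of the origin (or at it) at time t₀ cannot reach a point
-- z = ±d by time T, and one of the two choices of z leaves at most two robots
-- on the good side.  Let the target be z, with one of these two robots faulty
-- and silent.  If the other one, b, never reaches z, no reliable robot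
-- announces the target.  If b does, the robots cannot rule out that b alone
-- is faulty and the target is too far to have been visited at all.

open import Defs

open import Data.Empty using (⊥)
open import Data.Fin.Base using (Fin; zero; suc)
open import Data.Fin.Properties using (_≟_)
open import Data.Fin.Subset using (Subset; inside; outside; ∁; ⁅_⁆; ∣_∣; _∉_)
  renaming (_∈_ to _∈ˢ_; _-_ to _-ˢ_; ⊥ to ∅)
open import Data.Fin.Subset.Properties
  using (nonempty?; x∈p⇒∣p-x∣<∣p∣; x∈p∧x≢y⇒x∈p-y; ∣∁p∣≡n∸∣p∣; x∉∁p⇒x∈p;
         x∈⁅x⁆; ∣⁅x⁆∣≡1; ∣⊥∣≡0)
open import Data.List.Base using ([]; _∷_)
open import Data.List.Relation.Unary.Any using (here)
import Data.Nat.Base as ℕ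
import Data.Nat.Properties as ℕ
open import Data.Product.Base using (_×_; _,_; ∃-syntax; proj₁)
open import Data.Sum.Base using (_⊎_; inj₁; inj₂)
import Data.Vec.Base as Vec
open import Function.Base using (_∘_; id)
open import Function.Bundles using (mk⇔)
open import Relation.Binary.Bundles using (StrictPartialOrder)
open import Relation.Binary.Definitions using (tri<; tri≈; tri>)
open import Relation.Binary.Structures using (IsStrictTotalOrder)
import Relation.Binary.Reasoning.StrictPartialOrder as StrictReasoning
import Relation.Binary.PropositionalEquality.Core as ≡
open import Relation.Binary.PropositionalEquality.Core using (_≢_)
open import Relation.Nullary using (¬_; yes; no; contradiction)
import Algebra.Properties.Group as GroupProperties

-- Splitting finitely many robots between two properties

-- Membership records which branch of the disjunction was given. `P` and `Q` may overlap and need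
-- not be decidable.
separate : ∀ {n} {P Q : Fin n → Set} → (∀ i → P i ⊎ Q i) →
           ∃[ s ] (∀ i → i ∉ s → P i) × (∀ i → i ∈ˢ s → Q i)
separate {ℕ.zero}  _ = Vec.[] , (λ ()) , λ ()
separate {ℕ.suc n} h with separate (h ∘ suc) | h zero
... | s , out , ins | inj₁ p = outside Vec.∷ s
  , (λ { zero _ → p ; (suc i) i∉ → out i (i∉ ∘ Vec.there) })
  , λ { (suc i) (Vec.there i∈) → ins i i∈ }
... | s , out , ins | inj₂ q = inside Vec.∷ s
  , (λ { zero i∉ → contradiction Vec.here i∉ ; (suc i) i∉ → out i (i∉ ∘ Vec.there) })
  , λ { zero _ → q ; (suc i) (Vec.there i∈) → ins i i∈ }

-- A subset of an odd-sized set or its complement is less than half of it. Discarding the smaller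
-- one leaves only indices with a common property.
minority : ∀ k {P Q : Fin (ℕ.suc (k ℕ.+ k)) → Set} → (∀ i → P i ⊎ Q i) →
           ∃[ s ] ∣ s ∣ ℕ.≤ k × ((∀ i → i ∉ s → P i) ⊎ (∀ i → i ∉ s → Q i))
minority k h with separate h
... | s , out , ins with ∣ s ∣ ℕ.≤? k
... | yes s≤k = s , s≤k , inj₁ out
... | no  s≰k = ∁ s , ∁s≤k , inj₂ λ i i∉∁s → ins i (x∉∁p⇒x∈p i∉∁s)
  where
  open ℕ.≤-Reasoning
  ∁s≤k : ∣ ∁ s ∣ ℕ.≤ k
  ∁s≤k = begin
    ∣ ∁ s ∣                     ≡⟨ ∣∁p∣≡n∸∣p∣ s ⟩
    ℕ.suc (k ℕ.+ k) ℕ.∸ ∣ s ∣   ≤⟨ ℕ.∸-monoʳ-≤ (ℕ.suc (k ℕ.+ k)) (ℕ.≰⇒> s≰k) ⟩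
    ℕ.suc (k ℕ.+ k) ℕ.∸ ℕ.suc k ≡⟨ ℕ.m+n∸m≡n k k ⟩
    k                           ∎

-- Divides the exceptional robots into a single `b`, later the possible announcer, and a set `F`
-- small enough to be faulty.
dropOne : ∀ {n k} (s : Subset (ℕ.suc n)) → ∣ s ∣ ℕ.≤ ℕ.suc k →
          ∃[ b ] ∃[ F ] ∣ F ∣ ℕ.≤ k × (∀ {i} → i ≢ b → i ∉ F → i ∉ s)
dropOne {n} s ∣s∣≤ with nonempty? s
... | yes (b , b∈s) = b , s -ˢ b
  , ℕ.≤-pred (ℕ.≤-trans (x∈p⇒∣p-x∣<∣p∣ b∈s) ∣s∣≤)
  , λ i≢b i∉ i∈s → i∉ (x∈p∧x≢y⇒x∈p-y i∈s i≢b)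
-- With nothing to remove, any index can serve as `b`.
... | no empty = zero , ∅ , ℕ.≤-trans (ℕ.≤-reflexive (∣⊥∣≡0 (ℕ.suc n))) ℕ.z≤n
  , λ _ _ i∈s → empty (_ , i∈s)

-- Ordered field arithmetic

module OrderedField (R : RealNumbers) where
  open RealNumbers R
  open IsStrictTotalOrder isStrictTotalOrder public
    using (compare; irrefl; <-respʳ-≈; isStrictPartialOrder)
  open GroupProperties +-group public using ()
    renaming (//-rightDividesˡ to x-y+y≈x; //-rightDividesʳ to x+y-y≈x)

  strictPartialOrder : StrictPartialOrder _ _ _
  strictPartialOrder = record { isStrictPartialOrder = isStrictPartialOrder }

  open StrictReasoning strictPartialOrder hiding (start)

  ≤-refl : ∀ {x} → x ≤ x
  ≤-refl = inj₂ refl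

  ≤-trans : ∀ {x y z} → x ≤ y → y ≤ z → x ≤ z
  ≤-trans {x} {y} {z} x≤y y≤z = begin x ≤⟨ x≤y ⟩ y ≤⟨ y≤z ⟩ z ∎

  ≤⇒≯ : ∀ {x y} → x ≤ y → ¬ y < x
  ≤⇒≯ {x} {y} x≤y y<x = irrefl refl (begin-strict x ≤⟨ x≤y ⟩ y <⟨ y<x ⟩ x ∎)

  ≤-antisym : ∀ {x y} → x ≤ y → y ≤ x → x ≈ y
  ≤-antisym (inj₂ x≈y) _   = x≈y
  ≤-antisym (inj₁ x<y) y≤x = contradiction x<y (≤⇒≯ y≤x)

  ≤-or-> : ∀ x y → x ≤ y ⊎ y < x
  ≤-or-> x y with compare x y
  ... | tri< x<y _ _ = inj₁ (inj₁ x<y)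
  ... | tri≈ _ x≈y _ = inj₁ (inj₂ x≈y)
  ... | tri> _ _ y<x = inj₂ y<x

  ≮⇒≥ : ∀ {x y} → ¬ y < x → x ≤ y
  ≮⇒≥ {x} {y} y≮x with ≤-or-> x y
  ... | inj₁ x≤y = x≤y
  ... | inj₂ y<x = contradiction y<x y≮x

  ≰⇒> : ∀ {x y} → ¬ x ≤ y → y < x
  ≰⇒> {x} {y} x≰y with ≤-or-> x y
  ... | inj₁ x≤y = contradiction x≤y x≰y
  ... | inj₂ y<x = y<x

  +-monoʳ-< : ∀ z {x y} → x < y → z + x < z + y
  +-monoʳ-< z {x} {y} x<y = begin-strict
    z + x ≈⟨ +-comm z x ⟩
    x + z <⟨ +-monoˡ-< z x<y ⟩
    y + z ≈⟨ +-comm y z ⟩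
    z + y ∎

  +-monoˡ-≤ : ∀ z {x y} → x ≤ y → x + z ≤ y + z
  +-monoˡ-≤ z (inj₁ x<y) = inj₁ (+-monoˡ-< z x<y)
  +-monoˡ-≤ z (inj₂ x≈y) = inj₂ (+-congʳ x≈y)

  +-monoʳ-≤ : ∀ z {x y} → x ≤ y → z + x ≤ z + y
  +-monoʳ-≤ z (inj₁ x<y) = inj₁ (+-monoʳ-< z x<y)
  +-monoʳ-≤ z (inj₂ x≈y) = inj₂ (+-congˡ x≈y)

  +-mono-< : ∀ {w x y z} → w < x → y < z → w + y < x + z
  +-mono-< {w} {x} {y} {z} w<x y<z = begin-strict
    w + y <⟨ +-monoˡ-< y w<x ⟩
    x + y <⟨ +-monoʳ-< x y<z ⟩
    x + z ∎

  +-mono-≤ : ∀ {w x y z} → w ≤ x → y ≤ z → w + y ≤ x + z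
  +-mono-≤ {w} {x} {y} {z} w≤x y≤z = begin
    w + y ≤⟨ +-monoˡ-≤ y w≤x ⟩
    x + y ≤⟨ +-monoʳ-≤ x y≤z ⟩
    x + z ∎

  x≤y-z⇒x+z≤y : ∀ {x y z} → x ≤ y - z → x + z ≤ y
  x≤y-z⇒x+z≤y {x} {y} {z} x≤ = begin
    x + z     ≤⟨ +-monoˡ-≤ z x≤ ⟩
    y - z + z ≈⟨ x-y+y≈x z y ⟩
    y         ∎

  x-y≤z⇒x≤z+y : ∀ {x y z} → x - y ≤ z → x ≤ z + y
  x-y≤z⇒x≤z+y {x} {y} {z} ≤z = begin
    x         ≈⟨ x-y+y≈x y x ⟨
    x - y + y ≤⟨ +-monoˡ-≤ y ≤z ⟩
    z + y     ∎

  x-y<z⇒x<z+y : ∀ {x y z} → x - y < z → x < z + y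
  x-y<z⇒x<z+y {x} {y} {z} <z = begin-strict
    x         ≈⟨ x-y+y≈x y x ⟨
    x - y + y <⟨ +-monoˡ-< y <z ⟩
    z + y     ∎

  x<z+y⇒x-y<z : ∀ {x y z} → x < z + y → x - y < z
  x<z+y⇒x-y<z {x} {y} {z} x< = begin-strict
    x - y     <⟨ +-monoˡ-< (- y) x< ⟩
    z + y - y ≈⟨ x+y-y≈x y z ⟩
    z         ∎

  x≤y⇒0≤y-x : ∀ {x y} → x ≤ y → 0# ≤ y - x
  x≤y⇒0≤y-x {x} {y} x≤y = begin
    0#    ≈⟨ -‿inverseʳ x ⟨
    x - x ≤⟨ +-monoˡ-≤ (- x) x≤y ⟩
    y - x ∎

  2x≈x+x : ∀ x → 2# * x ≈ x + x
  2x≈x+x x = begin-equality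
    2# * x          ≈⟨ distribʳ x 1# 1# ⟩
    1# * x + 1# * x ≈⟨ +-cong (*-identityˡ x) (*-identityˡ x) ⟩
    x + x           ∎

  halve : ∀ x → ∃[ h ] h + h ≈ x
  halve x with invertible {2#} 2≉0
    where
    2≉0 : 2# ≉ 0#
    2≉0 2≈0 = irrefl refl (begin-strict
      0#      <⟨ 0<1 ⟩
      1#      ≈⟨ +-identityˡ 1# ⟨
      0# + 1# <⟨ +-monoˡ-< 1# 0<1 ⟩
      2#      ≈⟨ 2≈0 ⟩
      0#      ∎)
  ... | ½ , 2½≈1 = ½ * x , (begin-equality
    ½ * x + ½ * x ≈⟨ 2x≈x+x (½ * x) ⟨
    2# * (½ * x)  ≈⟨ *-assoc 2# ½ x ⟨
    2# * ½ * x    ≈⟨ *-congʳ 2½≈1 ⟩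
    1# * x        ≈⟨ *-identityˡ x ⟩
    x             ∎)

  double-cancel-< : ∀ {x y} → x + x < y + y → x < y
  double-cancel-< x+x<y+y = ≰⇒> λ y≤x → ≤⇒≯ (+-mono-≤ y≤x y≤x) x+x<y+y

  double-cancel-≤ : ∀ {x y} → x + x ≤ y + y → x ≤ y
  double-cancel-≤ x+x≤y+y = ≮⇒≥ λ y<x → ≤⇒≯ x+x≤y+y (+-mono-< y<x y<x)

  dense : ∀ {x y} → x < y → ∃[ m ] x < m × m < y
  dense {x} {y} x<y with halve (x + y)
  ... | m , m+m≈x+y = m
    , double-cancel-< (begin-strict
        x + x <⟨ +-monoʳ-< x x<y ⟩
        x + y ≈⟨ m+m≈x+y ⟨
        m + m ∎)
    , double-cancel-< (begin-strict
        m + m ≈⟨ m+m≈x+y ⟩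
        x + y <⟨ +-monoˡ-< y x<y ⟩
        y + y ∎)

  -- For limits from the left at `s`. The bound `0# ≤ r` is there because trajectories are
  -- constrained only from time zero on.
  slightlyBefore : ∀ {s h} → 0# < s → 0# < h → ∃[ r ] 0# ≤ r × r < s × s - r < h
  slightlyBefore {s} {h} 0<s 0<h with ≤-or-> h s
  ... | inj₂ s<h = 0# , ≤-refl , 0<s , x<z+y⇒x-y<z (begin-strict
    s      <⟨ s<h ⟩
    h      ≈⟨ +-identityʳ h ⟨
    h + 0# ∎)
  ... | inj₁ h≤s with dense (x<z+y⇒x-y<z (begin-strict
    s      ≈⟨ +-identityʳ s ⟨
    s + 0# <⟨ +-monoʳ-< s 0<h ⟩
    s + h  ∎))
  ... | r , s-h<r , r<s = r , ≤-trans (x≤y⇒0≤y-x h≤s) (inj₁ s-h<r) , r<s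
    , x<z+y⇒x-y<z (begin-strict
        s     <⟨ x-y<z⇒x<z+y s-h<r ⟩
        r + h ≈⟨ +-comm r h ⟩
        h + r ∎)

-- Consequences of the unit speed bound

module Trajectories (R : RealNumbers) {n f : ℕ.ℕ} where
  open RealNumbers R
  open OrderedField R
  open Search R n f
  open StrictReasoning strictPartialOrder hiding (start)

  module _ {p} (pt : IsTrajectory p) where
    open IsTrajectory pt

    ascent : ∀ {s t} → 0# ≤ s → s ≤ t → p t ≤ (t - s) + p s
    ascent 0≤s s≤t with speed 0≤s s≤t
    ... | up , _ = x-y≤z⇒x≤z+y up

    descent : ∀ {s t} → 0# ≤ s → s ≤ t → p s ≤ (t - s) + p t
    descent 0≤s s≤t with speed 0≤s s≤t
    ... | _ , down = x-y≤z⇒x≤z+y down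

    -- A position is a bare function on a setoid, so congruence is not automatic; the speed bound
    -- over an interval of length zero forces it.
    position-cong : ∀ {s t} → 0# ≤ s → s ≈ t → p s ≈ p t
    position-cong {s} {t} 0≤s s≈t = ≤-antisym
      (begin
        p s           ≤⟨ descent 0≤s (inj₂ s≈t) ⟩
        (t - s) + p t ≈⟨ +-congʳ t-s≈0 ⟩
        0# + p t      ≈⟨ +-identityˡ (p t) ⟩
        p t           ∎)
      (begin
        p t           ≤⟨ ascent 0≤s (inj₂ s≈t) ⟩
        (t - s) + p s ≈⟨ +-congʳ t-s≈0 ⟩
        0# + p s      ≈⟨ +-identityˡ (p s) ⟩
        p s           ∎)
      where
      t-s≈0 : t - s ≈ 0#
      t-s≈0 = trans (+-congʳ (sym s≈t)) (-‿inverseʳ s)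

    FirstVisit-cong : ∀ {x s t} → 0# ≤ s → s ≈ t → FirstVisit p x s → FirstVisit p x t
    FirstVisit-cong 0≤s s≈t (ps≈x , first) =
        trans (sym (position-cong 0≤s s≈t)) ps≈x
      , λ r 0≤r r<t → first r 0≤r (<-respʳ-≈ (sym s≈t) r<t)

    position≤time : ∀ {t} → 0# ≤ t → p t ≤ t
    position≤time {t} 0≤t = begin
      p t             ≤⟨ ascent ≤-refl 0≤t ⟩
      (t - 0#) + p 0# ≈⟨ +-congˡ start ⟩
      (t - 0#) + 0#   ≈⟨ x-y+y≈x 0# t ⟩
      t               ∎

    unvisited : ∀ {x t} → t < x → 0# ≤ t → p t ≉ x
    unvisited {x} {t} t<x 0≤t pt≈x = irrefl pt≈x (begin-strict
      p t ≤⟨ position≤time 0≤t ⟩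
      t   <⟨ t<x ⟩
      x   ∎)

  module _ {p q} (pt : IsTrajectory p) (qt : IsTrajectory q) {s} (0<s : 0# < s)
           (agree : ∀ r → 0# ≤ r → r < s → p r ≈ q r) where

    -- If `p s` exceeded `q s` by `h + h`, go back to a time `r` less than `h` before `s`, where the
    -- two agree. Since then each has moved by less than `h`, too little to open the gap.
    limit-≤ : p s ≤ q s
    limit-≤ = ≮⇒≥ λ q<p → step q<p (halve (p s - q s))
      where
      step : q s < p s → ¬ (∃[ h ] h + h ≈ p s - q s)
      step q<p (h , h+h≈) with slightlyBefore 0<s 0<h
        where
        0<h : 0# < h
        0<h = double-cancel-< (begin-strict
          0# + 0#   ≈⟨ +-identityˡ 0# ⟩
          0#        ≈⟨ -‿inverseʳ (q s) ⟨
          q s - q s <⟨ +-monoˡ-< (- q s) q<p ⟩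
          p s - q s ≈⟨ h+h≈ ⟨
          h + h     ∎)
      ... | r , 0≤r , r<s , s-r<h = irrefl refl (begin-strict
        p s                         ≤⟨ ascent pt 0≤r (inj₁ r<s) ⟩
        (s - r) + p r               ≈⟨ +-congˡ (agree r 0≤r r<s) ⟩
        (s - r) + q r               ≤⟨ +-monoʳ-≤ (s - r) (descent qt 0≤r (inj₁ r<s)) ⟩
        (s - r) + ((s - r) + q s)   ≈⟨ +-assoc (s - r) (s - r) (q s) ⟨
        ((s - r) + (s - r)) + q s   <⟨ +-monoˡ-< (q s) (+-mono-< s-r<h s-r<h) ⟩
        (h + h) + q s               ≈⟨ +-congʳ h+h≈ ⟩
        (p s - q s) + q s           ≈⟨ x-y+y≈x (q s) (p s) ⟩
        p s                         ∎)

  agreeBefore⇒agreeAt : ∀ {p q} → IsTrajectory p → IsTrajectory q → ∀ {s} → 0# < s →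
                        (∀ r → 0# ≤ r → r < s → p r ≈ q r) → p s ≈ q s
  agreeBefore⇒agreeAt pt qt 0<s agree = ≤-antisym
    (limit-≤ pt qt 0<s agree)
    (limit-≤ qt pt 0<s λ r 0≤r r<s → sym (agree r 0≤r r<s))

  FirstVisit-unique : ∀ {p x s t} → 0# ≤ s → 0# ≤ t →
                      FirstVisit p x s → FirstVisit p x t → s ≈ t
  FirstVisit-unique {s = s} {t} 0≤s 0≤t (ps≈x , s-first) (pt≈x , t-first) with compare s t
  ... | tri< s<t _ _ = contradiction ps≈x (t-first s 0≤s s<t)
  ... | tri≈ _ s≈t _ = s≈t
  ... | tri> _ _ t<s = contradiction pt≈x (s-first t 0≤t t<s)

  -- The origin counts as opposite to both points, so that every position is opposite to `d` or to
  -- `- d`.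
  Opposite : ℝ → ℝ → ℝ → Set
  Opposite d z y = (z ≈ d × y ≤ 0#) ⊎ (z ≈ - d × 0# ≤ y)

  -- From the wrong side of the origin, `z` is at least `d` away, which takes time `d` at unit
  -- speed.
  opposite⇒far : ∀ {p d z s t} → IsTrajectory p → Opposite d z (p s) →
                 0# ≤ s → s ≤ t → p t ≈ z → s + d ≤ t
  opposite⇒far {p} {d} {z} {s} {t} pt opp 0≤s s≤t pt≈z = begin
    s + d ≈⟨ +-comm s d ⟩
    d + s ≤⟨ x≤y-z⇒x+z≤y (d≤ opp) ⟩
    t     ∎
    where
    d≤ : Opposite d z (p s) → d ≤ t - s
    d≤ (inj₁ (z≈d , ps≤0)) = begin
      d             ≈⟨ trans pt≈z z≈d ⟨
      p t           ≤⟨ ascent pt 0≤s s≤t ⟩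
      (t - s) + p s ≤⟨ +-monoʳ-≤ (t - s) ps≤0 ⟩
      (t - s) + 0#  ≈⟨ +-identityʳ (t - s) ⟩
      t - s         ∎
    d≤ (inj₂ (z≈-d , 0≤ps)) = begin
      d                     ≈⟨ +-identityˡ d ⟨
      0# + d                ≤⟨ +-monoˡ-≤ d (≤-trans 0≤ps (descent pt 0≤s s≤t)) ⟩
      ((t - s) + p t) + d   ≈⟨ +-congʳ (+-congˡ (trans pt≈z z≈-d)) ⟩
      ((t - s) + - d) + d   ≈⟨ x-y+y≈x d (t - s) ⟩
      t - s                 ∎

  distance≤time : ∀ {p d z t} → IsTrajectory p → AtDistance d z →
                  0# ≤ t → p t ≈ z → d ≤ t
  distance≤time {p} {d} {z} {t} pt z-at 0≤t pt≈z = begin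
    d      ≈⟨ +-identityˡ d ⟨
    -- At time zero every robot is at the origin, hence opposite to `z`.
    0# + d ≤⟨ opposite⇒far pt (opposite z-at) ≤-refl 0≤t pt≈z ⟩
    t      ∎
    where
    open IsTrajectory pt
    opposite : AtDistance d z → Opposite d z (p 0#)
    opposite (inj₁ z≈d)  = inj₁ (z≈d , inj₂ start)
    opposite (inj₂ z≈-d) = inj₂ (z≈-d , inj₂ (sym start))

-- The adversary's runs against a fixed target

module Adversary (R : RealNumbers) {n f : ℕ.ℕ} where
  open RealNumbers R
  open Search R n f
  open OrderedField R
  open Trajectories R {n} {f}
  open StrictReasoning strictPartialOrder hiding (start)

  module _
    (A : Algorithm) {d t₀ T z : ℝ} (0<d : 0# < d) (z-at : AtDistance d z)
    (0≤t₀ : 0# ≤ t₀) (t₀<d : t₀ < d) (T<t₀+d : T < t₀ + d)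
    (F : Subset n) (∣F∣≤f : ∣ F ∣ ℕ.≤ f) (1≤f : 1 ℕ.≤ f) (b : Fin n)
    (opposite : ∀ {i} → i ≢ b → i ∉ F → Opposite d z (Algorithm.plan A i [] t₀))
    (bounded : SearchTime≤ A d T)
    where
    open Algorithm A

    z≉0 : z ≉ 0#
    z≉0 z≈0 = ≤⇒≯ (distance≤time (trajectory b []) z-at ≤-refl p0≈z) 0<d
      where
      p0≈z : plan b [] 0# ≈ z
      p0≈z = trans (IsTrajectory.start (trajectory b [])) (sym z≈0)

    -- The hypothesis `opposite` concerns the silent search. By causality it carries over to any log
    -- that is still silent up to `t₀`, and from there `z` is too far to reach by `T`.
    unreached : ∀ {i L} → i ≢ b → i ∉ F → AgreeUpTo t₀ L [] →
                ∀ {t} → 0# ≤ t → t ≤ T → plan i L t ≉ z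
    unreached {i} {L} i≢b i∉F agree {t} 0≤t t≤T pt≈z =
      ≤⇒≯ (≤-trans (opposite⇒far (trajectory i L) opp 0≤t₀ t₀≤t pt≈z) t≤T) T<t₀+d
      where
      t₀≤t : t₀ ≤ t
      t₀≤t = ≤-trans (inj₁ t₀<d) (distance≤time (trajectory i L) z-at 0≤t pt≈z)

      same : plan i L t₀ ≈ plan i [] t₀
      same = causal i 0≤t₀ agree

      transport : Opposite d z (plan i [] t₀) → Opposite d z (plan i L t₀)
      transport (inj₁ (e , y≤0)) = inj₁ (e , ≤-trans (inj₂ same) y≤0)
      transport (inj₂ (e , 0≤y)) = inj₂ (e , ≤-trans 0≤y (inj₂ (sym same)))

      opp : Opposite d z (plan i L t₀)
      opp = transport (opposite i≢b i∉F)

    -- Undecidable, but refuting both it and its negation yields the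
    -- contradiction without excluded middle.
    VisitsOnTime : Set
    VisitsOnTime = ∃[ s ] 0# ≤ s × s ≤ T × FirstVisit (plan b []) z s

    -- Otherwise no robot outside `F` reaches `z` by `T`, so the entirely silent search is a run
    -- with target `z`, and completion would need a message from the empty log.
    ¬unvisited : ¬ ¬ VisitsOnTime
    ¬unvisited none with bounded ρ z-at
      where
      no-visit : ∀ {i} → i ∉ F → ∀ {t} → 0# ≤ t → t ≤ T → ¬ FirstVisit (plan i []) z t
      no-visit {i} i∉F 0≤t t≤T v@(pt≈z , _) with i ≟ b
      ... | yes ≡.refl = none (_ , 0≤t , t≤T , v)
      ... | no  i≢b    = unreached i≢b i∉F (λ _ _ _ _ → mk⇔ id id) 0≤t t≤T pt≈z

      ρ : Run A T
      ρ = record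
        { target     = z
        ; target≉0   = z≉0
        ; faulty     = F
        ; few        = ∣F∣≤f
        ; position   = λ i → plan i []
        ; trajectory = λ i → trajectory i []
        ; log        = []
        ; located    = λ ()
        ; follows    = λ _ _ _ → refl
        ; reports    = λ i∉F 0≤t t≤T →
            mk⇔ (λ { (_ , ()) }) (λ v → contradiction v (no-visit i∉F 0≤t t≤T))
        }
    ... | _ , _ , (_ , _ , _ , _ , ()) , _

    -- Two runs share all positions and the log `L`: in `ρ` the robot `b` tells the truth and `F`
    -- stays silent, in `farRun` the robot `b` lies.
    ¬visited : ¬ VisitsOnTime
    ¬visited (s , 0≤s , s≤T , pbs≈z , pb-first) = refute (bounded ρ z-at)
      where
      L : Log
      L = (b , s , z) ∷ []

      d≤s : d ≤ s
      d≤s = distance≤time (trajectory b []) z-at 0≤s pbs≈z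

      silentBefore : ∀ {t} → t < s → AgreeUpTo t L []
      silentBefore t<s _ _ _ u≤t = mk⇔
        (λ { (here (_ , u≈s , _)) → contradiction t<s (≤⇒≯ (≤-trans (inj₂ (sym u≈s)) u≤t)) })
        λ ()

      t₀<s : t₀ < s
      t₀<s = begin-strict t₀ <⟨ t₀<d ⟩ d ≤⟨ d≤s ⟩ s ∎

      sameBefore : ∀ r → 0# ≤ r → r < s → plan b L r ≈ plan b [] r
      sameBefore r 0≤r r<s = causal b 0≤r (silentBefore r<s)

      -- Causality controls the plan only before the announcement at s; the
      -- speed bound extends this to s itself.
      visit : FirstVisit (plan b L) z s
      visit = trans (agreeBefore⇒agreeAt (trajectory b L) (trajectory b []) 0<s sameBefore) pbs≈z
        , λ r 0≤r r<s p≈z → pb-first r 0≤r r<s (trans (sym (sameBefore r 0≤r r<s)) p≈z)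
        where
        0<s : 0# < s
        0<s = begin-strict 0# <⟨ 0<d ⟩ d ≤⟨ d≤s ⟩ s ∎

      -- Serves both runs. The end time `t` varies because `Certain t` speaks of runs that last only
      -- until `t`.
      located : ∀ {t} → s ≤ t → ∀ {i u y} → (i , u , y) ∈ L →
                0# ≤ u × u ≤ t × plan i L u ≈ y
      located s≤t (here (≡.refl , u≈s , y≈z)) =
          ≤-trans 0≤s (inj₂ (sym u≈s))
        , ≤-trans (inj₂ u≈s) s≤t
        , trans (sym (position-cong (trajectory b L) 0≤s (sym u≈s))) (trans (proj₁ visit) (sym y≈z))

      ρ : Run A T
      ρ = record
        { target     = z
        ; target≉0   = z≉0
        ; faulty     = F
        ; few        = ∣F∣≤f
        ; position   = λ i → plan i L
        ; trajectory = λ i → trajectory i L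
        ; log        = L
        ; located    = located s≤T
        ; follows    = λ _ _ _ → refl
        ; reports    = λ i∉F 0≤t t≤T → mk⇔ announced⇒visit (visit⇒announced i∉F 0≤t t≤T)
        }
        where
        announced⇒visit : ∀ {i t} → ∃[ y ] (i , t , y) ∈ L → FirstVisit (plan i L) z t
        announced⇒visit (_ , here (≡.refl , t≈s , _)) =
          FirstVisit-cong (trajectory b L) 0≤s (sym t≈s) visit

        visit⇒announced : ∀ {i t} → i ∉ F → 0# ≤ t → t ≤ T →
                          FirstVisit (plan i L) z t → ∃[ y ] (i , t , y) ∈ L
        visit⇒announced {i} i∉F 0≤t t≤T v@(p≈z , _) with i ≟ b
        ... | yes ≡.refl = z , here (≡.refl , FirstVisit-unique 0≤t 0≤s v visit , refl)
        ... | no  i≢b    = contradiction p≈z (unreached i≢b i∉F (silentBefore t₀<s) 0≤t t≤T)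

      -- No robot can get this far by time `T`, so silence there is truthful.
      far : ℝ
      far = T + 1#

      T<far : T < far
      T<far = begin-strict
        T      ≈⟨ +-identityʳ T ⟨
        T + 0# <⟨ +-monoʳ-< T 0<1 ⟩
        far    ∎

      ≤T⇒<far : ∀ {t} → t ≤ T → t < far
      ≤T⇒<far {t} t≤T = begin-strict t ≤⟨ t≤T ⟩ T <⟨ T<far ⟩ far ∎

      farRun : ∀ {t} → s ≤ t → t ≤ T → Run A t
      farRun {t} s≤t t≤T = record
        { target     = far
        ; target≉0   = λ far≈0 → irrefl (sym far≈0) (≤T⇒<far (≤-trans 0≤s s≤T))
        ; faulty     = ⁅ b ⁆
        ; few        = ℕ.≤-trans (ℕ.≤-reflexive (∣⁅x⁆∣≡1 b)) 1≤f
        ; position   = λ i → plan i L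
        ; trajectory = λ i → trajectory i L
        ; log        = L
        ; located    = located s≤t
        ; follows    = λ _ _ _ → refl
        ; reports    = λ {i} i∉ 0≤u u≤t → mk⇔
            -- The only message comes from `b`, which is faulty in this run.
            (λ { (_ , here (≡.refl , _)) → contradiction (x∈⁅x⁆ b) i∉ })
            λ { (p≈far , _) → contradiction p≈far
                  (unvisited (trajectory i L) (≤T⇒<far (≤-trans u≤t t≤T)) 0≤u) }
        }

      -- The announcement required for completion can only be the one at `s`, so `s ≤ t` and
      -- `farRun` exists up to `t`. Certainty then identifies `far` with `z`, yet `b` stands at `z`
      -- at time `s`, too early for `far`.
      refute : ¬ (∃[ t ] t ≤ T × CompletedBy ρ t)
      refute (t , t≤T , (_ , _ , u , u≤t , here (_ , u≈s , _)) , certain) =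
        unvisited (trajectory b []) (≤T⇒<far s≤T) 0≤s (trans pbs≈z (sym far≈z))
        where
        far≈z : far ≈ z
        far≈z = certain (farRun (≤-trans (inj₂ (sym u≈s)) u≤t) t≤T)
                        (λ _ _ _ _ → mk⇔ id id)

    boundFails : ⊥
    boundFails = ¬unvisited ¬visited

-- Choosing the time, the target and the faulty robot

lemma7 : (R : RealNumbers) →
    let open RealNumbers R
        open Search R 5 1
    in (d : ℝ) → 0# < d → (A : Algorithm) → SearchTime≥ A d (2# * d)
lemma7 R d 0<d A T bounded = ≮⇒≥ λ T<2d → refute (midTime T<2d)
  where
  open RealNumbers R
  open Search R 5 1
  open Algorithm A
  open OrderedField R
  open Trajectories R {5} {1}
  open Adversary R {5} {1}
  open StrictReasoning strictPartialOrder

  midTime : T < 2# * d → ∃[ t₀ ] 0# ≤ t₀ × t₀ < d × T < t₀ + d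
  midTime T<2d with ≤-or-> 0# T | halve T
  -- `SearchTime≥` also ranges over negative `T`, whose half is not a valid time.
  ... | inj₂ T<0 | _ = 0# , ≤-refl , 0<d , (begin-strict
    T      <⟨ T<0 ⟩
    0#     <⟨ 0<d ⟩
    d      ≈⟨ +-identityˡ d ⟨
    0# + d ∎)
  -- Half of `T` works: it is less than `d`, and adding it to itself gives less than adding `d`.
  ... | inj₁ 0≤T | t₀ , 2t₀≈T = t₀
    , double-cancel-≤ (begin
        0# + 0# ≈⟨ +-identityˡ 0# ⟩
        0#      ≤⟨ 0≤T ⟩
        T       ≈⟨ 2t₀≈T ⟨
        t₀ + t₀ ∎)
    , t₀<d
    , (begin-strict
        T       ≈⟨ 2t₀≈T ⟨
        t₀ + t₀ <⟨ +-monoʳ-< t₀ t₀<d ⟩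
        t₀ + d  ∎)
    where
    t₀<d : t₀ < d
    t₀<d = double-cancel-< (begin-strict
      t₀ + t₀ ≈⟨ 2t₀≈T ⟩
      T       <⟨ T<2d ⟩
      2# * d  ≈⟨ 2x≈x+x d ⟩
      d + d   ∎)

  refute : ¬ (∃[ t₀ ] 0# ≤ t₀ × t₀ < d × T < t₀ + d)
  refute (t₀ , 0≤t₀ , t₀<d , T<t₀+d) = choose (minority 2 side)
    where
    side : ∀ i → plan i [] t₀ ≤ 0# ⊎ 0# ≤ plan i [] t₀
    side i with ≤-or-> (plan i [] t₀) 0#
    ... | inj₁ p≤0 = inj₁ p≤0
    ... | inj₂ 0<p = inj₂ (inj₁ 0<p)

    attack : ∀ {z} → AtDistance d z → (s : Subset 5) → ∣ s ∣ ℕ.≤ 2 →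
             ¬ (∀ i → i ∉ s → Opposite d z (plan i [] t₀))
    attack z-at s ∣s∣≤2 opposite with dropOne s ∣s∣≤2
    ... | b , F , ∣F∣≤1 , rest =
      boundFails A 0<d z-at 0≤t₀ t₀<d T<t₀+d F ∣F∣≤1 ℕ.≤-refl b
        (λ {i} i≢b i∉F → opposite i (rest i≢b i∉F)) bounded

    choose : ¬ (∃[ s ] ∣ s ∣ ℕ.≤ 2 × ((∀ i → i ∉ s → plan i [] t₀ ≤ 0#) ⊎
                                      (∀ i → i ∉ s → 0# ≤ plan i [] t₀)))
    choose (s , ∣s∣≤2 , inj₁ left)  =
      -- At least three robots are outside `s`; the target goes to the side away from them.
      attack (inj₁ refl) s ∣s∣≤2 λ i i∉s → inj₁ (refl , left i i∉s)
    choose (s , ∣s∣≤2 , inj₂ right) =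
      attack (inj₂ refl) s ∣s∣≤2 λ i i∉s → inj₂ (refl , right i i∉s)
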